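{- If $D$ is a de Bruijn digraph $B(d,M)$ or a Kautz digraph $K(d,M)$, with integers $d\ge 2$ and $M\ge 1$, then $F(D)=|V(D)|-2$.
   Context: The de Bruijn digraph $B(d,M)$ has vertex set $\{x_0x_1\cdots x_{M-1}: x_i\in\mathbb{Z}_d\}$ and arcs $(x_0x_1\cdots x_{M-1},\ x_1x_2\cdots x_M)$ (with $x_0,\dots,x_M\in\mathbb{Z}_d$); it has loops. The Kautz digraph $K(d,M)$ has vertex set $\{x_0x_1\cdots x_{M-1}: x_i\in\mathbb{Z}_{d+1},\ x_i\ne x_{i+1}\}$ and arcs $(x_0x_1\cdots x_{M-1},\ x_1x_2\cdots x_M)$ (with $x_0,\dots,x_M\in\mathbb{Z}_{d+1}$ and $x_i\neq x_{i+1}$ for $0\le i\le M-1$); it has no loops. For a digraph $H=(V,A)$, $N_H^+(v)=\{u:(v,u)\in A\}$ (containing $v$ if there is a loop at $v$). Zero forcing on a digraph $H$ without loops: for $S\subseteq V$, $B^0(S)=S$ and $B^{i+1}(S)=B^i(S)\cup\{w:\{w\}=N_H^+(v)\setminus B^i(S)\text{ for some }v\in B^i(S)\}$. On a digraph $H$ with (at least one) loop, the rule is instead $B^{i+1}(S)=B^i(S)\cup\{w:\{w\}=N_H^+(v)\setminus B^i(S)\text{ for some }v\in V\}$. In either case $S$ is a zero forcing set (ZFS) if $B^t(S)=V$ for some $t\ge 0$, and a failed zero forcing set (FZFS) otherwise. $F(H)$ is the largest cardinality of an FZFS of $H$ (when one exists). -}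

module Defs where

open import Data.Empty using (⊥-elim)
open import Data.Fin.Base using (Fin)
import Data.Fin.Properties as Fin
open import Data.Irrelevant using ([_])
open import Data.List.Base using (List; []; _∷_; length; filter; allFin; cartesianProductWith)
open import Data.List.Membership.Propositional using (_∈_; lose)
open import Data.List.Membership.Propositional.Properties
  using (∈-allFin; ∈-cartesianProductWith⁺)
open import Data.List.Relation.Unary.All as All using (All; []; _∷_)
open import Data.List.Relation.Unary.Any as Any using (here; there)
open import Data.List.Relation.Unary.AllPairs using ([]; _∷_)
open import Data.List.Relation.Unary.Unique.Propositional using (Unique)
open import Data.List.Relation.Unary.Unique.Propositional.Properties
  using (allFin⁺; cartesianProductWith⁺)
open import Data.Nat.Base using (ℕ; zero; suc; _≤_)
open import Data.Product.Base using (Σ-syntax; ∃-syntax; _×_; _,_)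
open import Data.Refinement using (Refinement-syntax; value; _,_)
open import Data.Vec.Base using (Vec; []; _∷_; init; tail)
open import Data.Vec.Properties using (≡-dec; ∷-injective)
open import Data.Vec.Relation.Unary.Linked using (Linked; linked?)
open import Level using (0ℓ)
open import Relation.Binary.Core using (Rel)
import Relation.Binary.Definitions as B
open import Relation.Binary.PropositionalEquality.Core using (_≡_; _≢_; refl; cong)
open import Relation.Nullary.Decidable.Core using (Dec; yes; no; recompute; map′; ¬?; _×-dec_)
open import Relation.Nullary.Negation.Core using (¬_)
open import Relation.Unary as U using (Pred; Universal; _≐_; _∖_; ｛_｝)

-- Finite digraphs; loops are allowed.  The duplicate-free enumeration
-- gives cardinalities, and `Arc?` makes the conditions below (such as
-- having a loop) decidable, as they are classically.

record Digraph : Set₁ where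
  field
    V        : Set
    Arc      : Rel V 0ℓ
    Arc?     : B.Decidable Arc
    vertices : List V
    complete : ∀ v → v ∈ vertices
    unique   : Unique vertices

  order : ℕ
  order = length vertices

  N⁺ : V → Pred V 0ℓ
  N⁺ v u = Arc v u

  HasLoop : Set
  HasLoop = ∃[ v ] Arc v v

  card : {S : Pred V 0ℓ} → U.Decidable S → ℕ
  card S? = length (filter S? vertices)

module ZeroForcing (H : Digraph) where
  open Digraph H

  Forces : Pred V 0ℓ → V → V → Set
  Forces B v w = ｛ w ｝ ≐ (N⁺ v ∖ B)

  data Step (B : Pred V 0ℓ) : Pred V 0ℓ where
    keep          : ∀ {w} → B w → Step B w
    forceLoopless : ∀ {v w} → ¬ HasLoop → B v → Forces B v w → Step B w
    forceLooped   : ∀ {v w} → HasLoop → Forces B v w → Step B w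

  B[_] : ℕ → Pred V 0ℓ → Pred V 0ℓ
  B[ zero  ] S = S
  B[ suc i ] S = Step (B[ i ] S)

  ZFS : Pred V 0ℓ → Set
  ZFS S = ∃[ t ] Universal (B[ t ] S)

  FZFS : Pred V 0ℓ → Set
  FZFS S = ¬ ZFS S

-- `F H ≔ k` means that F(H) exists and equals k, that is, k is the largest
-- cardinality of a failed zero forcing set.  Subsets of the finite vertex
-- set are the decidable predicates.

infix 4 F_≔_

F_≔_ : Digraph → ℕ → Set₁
F H ≔ k =
    (Σ[ S ∈ Pred V 0ℓ ] Σ[ S? ∈ U.Decidable S ] (FZFS S × card S? ≡ k))
  × (∀ (S : Pred V 0ℓ) (S? : U.Decidable S) → FZFS S → card S? ≤ k)
  where
  open Digraph H
  open ZeroForcing H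

Word : ℕ → ℕ → Set
Word d M = Vec (Fin d) M

_≟ʷ_ : ∀ {d M} → B.DecidableEquality (Word d M)
_≟ʷ_ = ≡-dec Fin._≟_

words : ∀ d M → List (Word d M)
words d zero    = [] ∷ []
words d (suc M) = cartesianProductWith _∷_ (allFin d) (words d M)

words-complete : ∀ d M (x : Word d M) → x ∈ words d M
words-complete d zero    []      = here refl
words-complete d (suc M) (a ∷ x) =
  ∈-cartesianProductWith⁺ _∷_ (∈-allFin a) (words-complete d M x)

words-unique : ∀ d M → Unique (words d M)
words-unique d zero    = [] ∷ []
words-unique d (suc M) =
  cartesianProductWith⁺ _∷_ ∷-injective (allFin⁺ d) (words-unique d M)

module _ {A : Set} {P : Pred A 0ℓ} (P? : U.Decidable P) where

  restrict : List A → List [ x ∈ A ∣ P x ]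
  restrict []       = []
  restrict (x ∷ xs) with P? x
  ... | yes p = (x , [ p ]) ∷ restrict xs
  ... | no  _ = restrict xs

  ∈-restrict : ∀ {xs} (v : [ x ∈ A ∣ P x ]) → value v ∈ xs → v ∈ restrict xs
  ∈-restrict {x ∷ xs} (y , [ p ]) y∈ with P? x | y∈
  ... | yes _ | here refl = here refl
  ... | no ¬p | here refl = ⊥-elim (¬p (recompute (P? y) p))
  ... | yes _ | there q   = there (∈-restrict (y , [ p ]) q)
  ... | no  _ | there q   = ∈-restrict (y , [ p ]) q

  restrict-≢ : ∀ {y xs} → All (y ≢_) xs → All (λ v → y ≢ value v) (restrict xs)
  restrict-≢ []                     = []
  restrict-≢ {xs = x ∷ _} (y≢x ∷ h) with P? x
  ... | yes _ = y≢x ∷ restrict-≢ h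
  ... | no  _ = restrict-≢ h

  restrict-unique : ∀ {xs} → Unique xs → Unique (restrict xs)
  restrict-unique []                    = []
  restrict-unique {xs = x ∷ _} (x∉ ∷ u) with P? x
  ... | yes _ = All.map (λ x≢v e → x≢v (cong value e)) (restrict-≢ x∉) ∷ restrict-unique u
  ... | no  _ = restrict-unique u

search : ∀ {A : Set} {P : Pred A 0ℓ} (xs : List A) → (∀ x → x ∈ xs) →
         U.Decidable P → Dec (∃[ x ] P x)
search xs complete P? =
  map′ Any.satisfied (λ (x , p) → lose (complete x) p) (Any.any? P? xs)

-- An arc is witnessed by the word z = x₀x₁⋯x_M, running from its first M
-- letters to its last M letters.

deBruijn : ℕ → ℕ → Digraph
deBruijn d M = record
  { V        = Word d M
  ; Arc      = λ x y → ∃[ z ] (init {n = M} z ≡ x × tail z ≡ y)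
  ; Arc?     = λ x y → search (words d (suc M)) (words-complete d (suc M))
                         (λ z → (init z ≟ʷ x) ×-dec (tail z ≟ʷ y))
  ; vertices = words d M
  ; complete = words-complete d M
  ; unique   = words-unique d M
  }

-- The proof that consecutive letters differ is irrelevant, so equality of
-- Kautz words is equality of the underlying words.

KautzWord : ℕ → ℕ → Set
KautzWord d M = [ x ∈ Word (suc d) M ∣ Linked _≢_ x ]

kautzWords : ∀ d M → List (KautzWord d M)
kautzWords d M = restrict (linked? (λ a b → ¬? (a Fin.≟ b))) (words (suc d) M)

kautzWords-complete : ∀ d M (x : KautzWord d M) → x ∈ kautzWords d M
kautzWords-complete d M x = ∈-restrict _ x (words-complete (suc d) M (value x))

kautz : ℕ → ℕ → Digraph
kautz d M = record
  { V        = KautzWord d M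
  ; Arc      = λ x y → Σ[ z ∈ KautzWord d (suc M) ]
                         (init (value z) ≡ value x × tail (value z) ≡ value y)
  ; Arc?     = λ x y → search (kautzWords d (suc M)) (kautzWords-complete d (suc M))
                         (λ z → (init (value z) ≟ʷ value x) ×-dec (tail (value z) ≟ʷ value y))
  ; vertices = kautzWords d M
  ; complete = kautzWords-complete d M
  ; unique   = restrict-unique _ (words-unique (suc d) M)
  }

{-# OPTIONS --safe #-}

-- Lower bound: if every arc into u also gives an arc into w and conversely,
-- then no vertex can force one of u and w while both are missing, so V ∖ {u , w}
-- is a failed zero forcing set.  Words differing only in the last letter are
-- such a pair.  (For K(d,1) this fails for the arcs between u and w themselves,
-- but without loops a vertex outside the set does not force.)
-- Upper bound: a set missing only w is zero forcing, since any in-neighbour of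
-- w forces it.

module Submission where

open import Defs
open import Data.Fin.Base using (Fin; zero; suc; punchIn)
open import Data.Fin.Properties using (punchInᵢ≢i)
open import Data.Irrelevant using ([_])
open import Data.List.Base using (List; []; _∷_; length; filter)
open import Data.List.Membership.Propositional using (_∈_; _∉_)
open import Data.List.Membership.Propositional.Properties using (∈-filter⁺; ∈-filter⁻)
import Data.List.Membership.DecPropositional as DecMembership
open import Data.List.Membership.Propositional.Properties.WithK using (unique∧set⇒bag)
open import Data.List.Relation.Binary.BagAndSetEquality using (∼bag⇒↭)
open import Data.List.Relation.Binary.Permutation.Propositional.Properties using (↭-length)
open import Data.List.Relation.Unary.All using ([]; _∷_)
open import Data.List.Relation.Unary.AllPairs using ([]; _∷_)
open import Data.List.Relation.Unary.Any using (here; there)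
open import Data.List.Relation.Unary.Unique.Propositional using (Unique)
open import Data.List.Relation.Unary.Unique.Propositional.Properties using (filter⁺)
open import Data.Nat.Base using (ℕ; zero; suc; _+_; _≤_; _∸_; z≤n; s≤s)
open import Data.Nat.Properties using (m+n∸n≡m; m≤m+n; +-suc; +-∸-assoc; module ≤-Reasoning)
open import Data.Product.Base using (∃-syntax; _×_; _,_; proj₁; proj₂)
open import Data.Refinement using (value; value-injective; _,_)
import Data.Refinement as Refinement
open import Data.Sum.Base using (_⊎_; inj₁; inj₂)
open import Data.Vec.Base using (Vec; []; _∷_; init; head)
open import Data.Vec.Properties using (∷-injectiveˡ; ∷-injectiveʳ)
open import Data.Vec.Relation.Unary.Linked as Linked using (Linked; []; [-]; _∷_)
open import Function.Base using (_∘_; case_of_; const)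
open import Function.Bundles using (mk⇔)
open import Level using (0ℓ)
open import Relation.Binary.Core using (Rel)
open import Relation.Binary.Definitions using (DecidableEquality)
open import Relation.Binary.PropositionalEquality
  using (_≡_; _≢_; refl; sym; trans; cong; subst; module ≡-Reasoning)
open import Relation.Nullary.Decidable using (yes; no; decidable-stable)
open import Relation.Nullary.Negation using (¬_; contradiction; contradiction-irr)
open import Relation.Unary using (Pred; Decidable; Universal; _⊆_)
open import Relation.Unary.Properties using (∁?)

private
  variable
    A : Set
    d n : ℕ

-- Counting in finite lists.

length-filter-∁ : {P : Pred A 0ℓ} (P? : Decidable P) (xs : List A) →
                  length (filter P? xs) + length (filter (∁? P?) xs) ≡ length xs
length-filter-∁ P? []       = refl
length-filter-∁ P? (x ∷ xs) with P? x
... | yes _ = cong suc (length-filter-∁ P? xs)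
... | no  _ = trans (+-suc _ _) (cong suc (length-filter-∁ P? xs))

-- Serves to count the vertices missing from a set without knowing the order in which the
-- enumeration lists them.
unique∧set⇒length : {xs ys : List A} → Unique xs → Unique ys →
                    (∀ {x} → x ∈ xs → x ∈ ys) → (∀ {x} → x ∈ ys → x ∈ xs) →
                    length xs ≡ length ys
unique∧set⇒length ux uy f g = ↭-length (∼bag⇒↭ (unique∧set⇒bag ux uy (mk⇔ f g)))

-- Both bounds for an arbitrary finite digraph.

module _ (H : Digraph) where
  open Digraph H
  open ZeroForcing H

  -- The premise holds whenever `v` may force while `w` is missing: with loops every vertex may
  -- force, without them only vertices of the set, hence not `w` itself.
  Dominates : V → V → Set
  Dominates w u = ∀ {v} → HasLoop ⊎ v ≢ w → Arc v u → Arc v w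

  missing : {S : Pred V 0ℓ} → Decidable S → List V
  missing S? = filter (∁? S?) vertices

  module _ {S : Pred V 0ℓ} (S? : Decidable S) where

    card+missing : card S? + length (missing S?) ≡ order
    card+missing = length-filter-∁ S? vertices

    ∈-missing : ∀ {v} → ¬ S v → v ∈ missing S?
    ∈-missing {v} = ∈-filter⁺ (∁? S?) (complete v)

    missing⇒∉ : ∀ {v} → v ∈ missing S? → ¬ S v
    missing⇒∉ v∈ = proj₂ (∈-filter⁻ (∁? S?) {xs = vertices} v∈)

    ∉missing⇒∈ : ∀ {v} → v ∉ missing S? → S v
    ∉missing⇒∈ {v} v∉ = decidable-stable (S? v) (v∉ ∘ ∈-missing)

    missing≡[]⇒ZFS : missing S? ≡ [] → ZFS S
    missing≡[]⇒ZFS eq = 0 , λ v → ∉missing⇒∈ λ v∈ → case subst (v ∈_) eq v∈ of λ ()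

    missing≡[w]⇒ZFS : (∀ w → ∃[ v ] Arc v w) → ∀ {w} → missing S? ≡ w ∷ [] → ZFS S
    missing≡[w]⇒ZFS inNeighbour {w} eq = 1 , forced
      where
      v : V
      v = proj₁ (inNeighbour w)

      v→w : Arc v w
      v→w = proj₂ (inNeighbour w)

      w∉S : ¬ S w
      w∉S = missing⇒∉ (subst (w ∈_) (sym eq) (here refl))

      only-w : ∀ {x} → ¬ S x → w ≡ x
      only-w {x} x∉S with here x≡w ← subst (x ∈_) eq (∈-missing x∉S) = sym x≡w

      v-forces-w : Forces S v w
      v-forces-w = (λ { refl → v→w , w∉S }) , (λ (_ , x∉S) → only-w x∉S)

      -- Which forcing rule applies depends on the existence of a loop, decidable by searching the
      -- finite vertex set.
      hasLoop? = search vertices complete (λ x → Arc? x x)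

      forced : Universal (Step S)
      forced x with S? x
      ... | yes x∈S = keep x∈S
      ... | no  x∉S with refl ← only-w x∉S | hasLoop?
      ...   | yes loop  = forceLooped loop v-forces-w
      ...   | no  ¬loop = forceLoopless ¬loop v∈S v-forces-w
        where
        -- Otherwise `v` is the one missing vertex `w`, and `v→w` is a loop.
        v∈S : S v
        v∈S = decidable-stable (S? v) λ v∉S →
          ¬loop (w , subst (λ y → Arc y w) (sym (only-w v∉S)) v→w)

    FZFS⇒card≤ : (∀ w → ∃[ v ] Arc v w) → FZFS S → card S? ≤ order ∸ 2
    FZFS⇒card≤ inNeighbour failed with missing S? in eq | card+missing
    ... | []         | _     = contradiction (missing≡[]⇒ZFS eq) failed
    ... | w ∷ []     | _     = contradiction (missing≡[w]⇒ZFS inNeighbour eq) failed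
    -- Two or more vertices are missing, so the truncated subtraction of 2 is exact.
    ... | _ ∷ _ ∷ xs | total = begin
      card S?                              ≤⟨ m≤m+n (card S?) (length xs) ⟩
      card S? + length xs                  ≡⟨ +-∸-assoc (card S?) {2 + length xs} (s≤s (s≤s z≤n)) ⟨
      (card S? + (2 + length xs)) ∸ 2      ≡⟨ cong (_∸ 2) total ⟩
      order ∸ 2                            ∎
      where open ≤-Reasoning

  module _ (_≟_ : DecidableEquality V) {u w : V} (u≢w : u ≢ w)
           (w≥u : Dominates w u) (u≥w : Dominates u w) where
    open DecMembership _≟_ using (_∈?_; _∉?_)

    Rest : Pred V 0ℓ
    Rest = _∉ u ∷ w ∷ []

    Rest? : Decidable Rest
    Rest? = _∉? u ∷ w ∷ []

    -- If `v` forced `u`, domination would put `w` into `N⁺ v ∖ B` too, and a singleton cannot hold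
    -- both; likewise with `u` and `w` exchanged. `B` is any subset of `Rest`, so that every stage
    -- of the process is covered.
    unforceable : {B : Pred V 0ℓ} → B ⊆ Rest → ∀ {v x} →
                  HasLoop ⊎ Rest v → Forces B v x → Rest x
    unforceable B⊆ {v} loop⊎v (⊆N , N⊆) (here refl) =
      u≢w (N⊆ (w≥u (avoid loop⊎v) (proj₁ (⊆N refl)) , λ w∈B → B⊆ w∈B (there (here refl))))
      where
      avoid : HasLoop ⊎ Rest v → HasLoop ⊎ v ≢ w
      avoid (inj₁ loop) = inj₁ loop
      avoid (inj₂ v∈)   = inj₂ λ v≡w → v∈ (there (here v≡w))
    unforceable B⊆ {v} loop⊎v (⊆N , N⊆) (there (here refl)) =
      u≢w (sym (N⊆ (u≥w (avoid loop⊎v) (proj₁ (⊆N refl)) , λ u∈B → B⊆ u∈B (here refl))))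
      where
      avoid : HasLoop ⊎ Rest v → HasLoop ⊎ v ≢ u
      avoid (inj₁ loop) = inj₁ loop
      avoid (inj₂ v∈)   = inj₂ λ v≡u → v∈ (here v≡u)

    -- Induction on the stages. For the loopless rule the induction hypothesis also places the
    -- forcing vertex in `Rest`, so it is neither `u` nor `w`.
    B[_]⊆Rest : ∀ t → B[ t ] Rest ⊆ Rest
    B[ zero  ]⊆Rest x∈ = x∈
    B[ suc t ]⊆Rest (keep x∈) = B[ t ]⊆Rest x∈
    B[ suc t ]⊆Rest (forceLoopless _ v∈ f) =
      unforceable B[ t ]⊆Rest (inj₂ (B[ t ]⊆Rest v∈)) f
    B[ suc t ]⊆Rest (forceLooped loop f) = unforceable B[ t ]⊆Rest (inj₁ loop) f

    Rest-FZFS : FZFS Rest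
    Rest-FZFS (t , forced) = B[ t ]⊆Rest (forced u) (here refl)

    card-Rest : card Rest? ≡ order ∸ 2
    card-Rest = begin
      card Rest?                                   ≡⟨ m+n∸n≡m (card Rest?) 2 ⟨
      (card Rest? + 2) ∸ 2                         ≡⟨ cong (λ k → (card Rest? + k) ∸ 2) two ⟨
      (card Rest? + length (missing Rest?)) ∸ 2    ≡⟨ cong (_∸ 2) (card+missing Rest?) ⟩
      order ∸ 2                                    ∎
      where
      open ≡-Reasoning
      two : length (missing Rest?) ≡ 2
      two = unique∧set⇒length (filter⁺ (∁? Rest?) unique) ((u≢w ∷ []) ∷ [] ∷ [])
        -- Being outside `Rest` is a doubly negated membership, which decidability makes positive.
        (λ {x} x∈ → decidable-stable (x ∈? u ∷ w ∷ []) (missing⇒∉ Rest? x∈))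
        (λ x∈ → ∈-missing Rest? (λ x∉ → x∉ x∈))

    F≔order∸2 : (∀ w → ∃[ v ] Arc v w) → F H ≔ order ∸ 2
    F≔order∸2 inNeighbour =
        (Rest , Rest? , Rest-FZFS , card-Rest)
      , λ S S? → FZFS⇒card≤ S? inNeighbour

-- Arcs into a word of a de Bruijn or Kautz digraph.

deBruijn-inNeighbour : ∀ (y : Word d (suc n)) → ∃[ x ] Digraph.Arc (deBruijn d (suc n)) x y
-- Any letter may precede `y`; its own first letter is at hand.
deBruijn-inNeighbour y = init (head y ∷ y) , head y ∷ y , refl , refl

-- The source of an arc is one letter followed by `init` of the target, so the last letter of the
-- target does not affect it.
deBruijn-dominates : {u w : Word d (suc n)} → init u ≡ init w →
                     Dominates (deBruijn d (suc n)) w u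
deBruijn-dominates {w = w} eq _ (a ∷ _ , refl , refl) = a ∷ w , cong (a ∷_) (sym eq) , refl

init-Linked : {R : Rel A 0ℓ} {xs : Vec A (suc n)} → Linked R xs → Linked R (init xs)
init-Linked [-]               = []
init-Linked (_ ∷ [-])         = [-]
init-Linked (r ∷ rs@(_ ∷ _)) = r ∷ init-Linked rs

kautz-inNeighbour : 1 ≤ d → ∀ y → ∃[ x ] Digraph.Arc (kautz d (suc n)) x y
kautz-inNeighbour (s≤s _) (y@(b ∷ _) , [ p ]) =
    (init (c ∷ y) , [ init-Linked (c≢b ∷ p) ])
  , (c ∷ y , [ c≢b ∷ p ]) , refl , refl
  where
  -- A letter other than `b`: since `1 ≤ d`, there are at least two letters.
  c = punchIn b zero
  c≢b = punchInᵢ≢i b zero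

-- A loop makes `init` and `tail` of the arc word agree, so its first two letters coincide.
kautz-loopless : ¬ Digraph.HasLoop (kautz d (suc n))
kautz-loopless ((x , _) , (a ∷ b ∷ _ , [ p ]) , init≡x , tail≡x) =
  contradiction-irr (Linked.head p) λ a≢b → a≢b (cong head (trans init≡x (sym tail≡x)))

-- Replacing the target `u` by `w` leaves only the junction with the preceding letter `c` to check.
-- In length at least two, `u` and `w` share their first letter; in length one, the junction
-- condition is `v ≢ w`.
kautz-dominates : {u w : KautzWord d (suc n)} → init (value u) ≡ init (value w) →
                  Dominates (kautz d (suc n)) w u
kautz-dominates eq (inj₁ loop) _ = contradiction loop kautz-loopless
kautz-dominates {n = zero} {w = b ∷ [] , _} _ (inj₂ v≢w) ((c ∷ a ∷ [] , _) , init≡v , _) =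
  (c ∷ b ∷ [] , [ c≢b ∷ [-] ]) , init≡v , refl
  where
  c≢b : c ≢ b
  c≢b refl = v≢w (value-injective (sym init≡v))
kautz-dominates {n = suc _} {w = b ∷ w , [ q ]} eq (inj₂ _) ((c ∷ a ∷ u , [ p ]) , init≡v , refl) =
    (c ∷ b ∷ w , [ subst (c ≢_) (∷-injectiveˡ eq) (Linked.head p) ∷ q ])
  , trans (cong (c ∷_) (sym eq)) init≡v , refl

-- Pairs of words that differ only in the last letter.

-- c i is the letter i + 1 places before the last one.
block : (ℕ → A) → A → ∀ n → Vec A (suc n)
block c a zero    = a ∷ []
block c a (suc n) = c n ∷ block c a n

init-block : ∀ (c : ℕ → A) a b n → init (block c a n) ≡ init (block c b n)
init-block c a b zero    = refl
init-block c a b (suc n) = cong (c n ∷_) (init-block c a b n)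

block-injective : ∀ (c : ℕ → A) {a b} n → block c a n ≡ block c b n → a ≡ b
block-injective c zero    refl = refl
block-injective c (suc n) eq   = block-injective c n (∷-injectiveʳ eq)

block-Linked : {R : Rel A 0ℓ} {c : ℕ → A} {a : A} → R (c 0) a → (∀ i → R (c (suc i)) (c i)) →
               ∀ n → Linked R (block c a n)
block-Linked r rs zero          = [-]
block-Linked r rs (suc zero)    = r ∷ [-]
block-Linked r rs (suc (suc n)) = rs n ∷ block-Linked r rs (suc n)

-- The letter 2 comes just before the last place, so the word may end in 0 or in 1; further left 0
-- and 2 alternate.
alternate : ℕ → Fin (3 + d)
alternate zero          = suc (suc zero)
alternate (suc zero)    = zero
alternate (suc (suc i)) = alternate i

alternate-≢ : ∀ i → alternate {d} (suc i) ≢ alternate i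
alternate-≢ zero    ()
-- Period two turns this into the previous case with its sides swapped.
alternate-≢ (suc i) eq = alternate-≢ i (sym eq)

corollary4p22 : (d M : ℕ) → 2 ≤ d → 1 ≤ M →
    (F deBruijn d M ≔ Digraph.order (deBruijn d M) ∸ 2)
    × (F kautz d M ≔ Digraph.order (kautz d M) ∸ 2)
corollary4p22 (suc (suc d)) (suc m) (s≤s (s≤s _)) (s≤s _) =
    -- The pair 0⋯00 and 0⋯01.
    F≔order∸2 (deBruijn _ _) _≟ʷ_ (λ eq → case block-injective c {zero} {suc zero} m eq of λ ())
      (deBruijn-dominates (init-block c zero (suc zero) m))
      (deBruijn-dominates (init-block c (suc zero) zero m))
      deBruijn-inNeighbour
  -- The pair ⋯2020 and ⋯2021, cut to length `suc m` from the right end.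
  , F≔order∸2 (kautz _ _) (Refinement._≟_ _≟ʷ_)
      (λ eq → case block-injective alternate {zero} {suc zero} m (cong value eq) of λ ())
      (kautz-dominates {u = k₀} {w = k₁} (init-block alternate zero (suc zero) m))
      (kautz-dominates {u = k₁} {w = k₀} (init-block alternate (suc zero) zero m))
      (kautz-inNeighbour (s≤s z≤n))
  where
  c : ℕ → Fin (2 + d)
  c = const zero

  k₀ k₁ : KautzWord (2 + d) (suc m)
  k₀ = block alternate zero m , [ block-Linked (λ ()) alternate-≢ m ]
  k₁ = block alternate (suc zero) m , [ block-Linked (λ ()) alternate-≢ m ]
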